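{- Let $\varepsilon\in\{\pm1\}$ and let $(c_1,\dots,c_m)\in\mathbb{Z}^m$ be an $\varepsilon$-cycle. Indices are read cyclically modulo $m$. Then at least one of the following holds: (0) $m=2$ and $(c_1,c_2)=(0,0)$; (1) there is $k$ with $c_k=1$ such that $(c_1,\dots,c_{k-2},c_{k-1}-1,c_{k+1}-1,c_{k+2},\dots,c_m)$ is an $\varepsilon$-cycle of length $m-1$; (2) there is $k$ with $c_k=0$ such that $(c_1,\dots,c_{k-2},c_{k-1}+c_{k+1},c_{k+2},\dots,c_m)$ is a $(-\varepsilon)$-cycle of length $m-2$; (3) there is $k$ with $c_k=-1$ such that $(c_1,\dots,c_{k-2},c_{k-1}+1,c_{k+1}+1,c_{k+2},\dots,c_m)$ is a $(-\varepsilon)$-cycle of length $m-1$.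
   Context: $\eta(c)=\begin{pmatrix}c&-1\\1&0\end{pmatrix}$. For $\varepsilon\in\{\pm1\}$, an $\varepsilon$-cycle is a sequence $(c_1,\dots,c_m)\in\mathbb{Z}^m$ with $\eta(c_1)\cdots\eta(c_m)=\varepsilon I$. -}

module Defs where

open import Data.Fin.Base using (Fin; toℕ; punchOut)
open import Data.Fin.Properties using (toℕ-fromℕ<; toℕ<n)
open import Data.Integer.Base using (ℤ; 0ℤ; 1ℤ; -1ℤ; _+_; _*_; _◃_)
open import Data.Nat.Base as ℕ using (ℕ; zero; suc; _∸_)
open import Data.Nat.DivMod using (_mod_; _%_; m%n<n; n%n≡0; m<n⇒m%n≡m)
open import Data.Nat.Properties using (1+n≢n; m≤n⇒m<n∨m≡n)
open import Data.Sign.Base using (Sign)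
open import Data.Sum.Base using (inj₁; inj₂)
open import Data.Vec.Base using (Vec; []; foldr′; map; lookup; removeAt; updateAt)
open import Relation.Binary.PropositionalEquality
  using (_≡_; _≢_; refl; sym; trans; cong)

-- mat a b c d is the matrix with rows (a , b) and (c , d).
record Mat₂ : Set where
  constructor mat
  field
    e₁₁ e₁₂ e₂₁ e₂₂ : ℤ

infixl 7 _·_

_·_ : Mat₂ → Mat₂ → Mat₂
mat a b c d · mat a′ b′ c′ d′ =
  mat (a * a′ + b * c′) (a * b′ + b * d′)
      (c * a′ + d * c′) (c * b′ + d * d′)

scalar : ℤ → Mat₂
scalar x = mat x 0ℤ 0ℤ x

η : ℤ → Mat₂
η c = mat c -1ℤ 1ℤ 0ℤ

ηProduct : ∀ {m} → Vec ℤ m → Mat₂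
ηProduct c = foldr′ _·_ (scalar 1ℤ) (map η c)

-- Elements of {±1} are represented by Sign; ε ◃ 1 is ε as an integer.
IsCycle : Sign → ∀ {m} → Vec ℤ m → Set
IsCycle ε c = ηProduct c ≡ scalar (ε ◃ 1)

-- Cyclic neighbours k + 1 and k - 1 of an index k (positions are numbered
-- from 0, and k - 1 is computed as k + (m - 1) modulo m).
next prev : ∀ {n} → Fin (suc n) → Fin (suc n)
next {n} k = suc (toℕ k) mod suc n
prev {n} k = (toℕ k ℕ.+ n) mod suc n

toℕ-next : ∀ {n} (k : Fin (suc n)) → toℕ (next k) ≡ suc (toℕ k) % suc n
toℕ-next {n} k = toℕ-fromℕ< (m%n<n (suc (toℕ k)) (suc n))

k≢next : ∀ {n} (k : Fin (2 ℕ.+ n)) → k ≢ next k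
k≢next {n} k k≡next with trans (cong toℕ k≡next) (toℕ-next k) | m≤n⇒m<n∨m≡n (toℕ<n k)
... | eq | inj₁ 1+k<m = 1+n≢n (sym (trans eq (m<n⇒m%n≡m 1+k<m)))
... | eq | inj₂ 1+k≡m with () ←
  trans (sym 1+k≡m) (cong suc (trans eq
    (trans (cong (_% (2 ℕ.+ n)) 1+k≡m) (n%n≡0 (2 ℕ.+ n)))))

-- Delete c_k and add δ to both of its cyclic neighbours.  This is the
-- intended operation only for m ≥ 3, where the neighbours c_{k-1} and c_{k+1}
-- occupy two positions distinct from each other and from k.
contract : ∀ {m} → ℤ → Vec ℤ m → Fin m → Vec ℤ (m ∸ 1)
contract {suc n} δ c k =
  removeAt (updateAt (updateAt c (prev k) (_+ δ)) (next k) (_+ δ)) k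

-- Replace the cyclically consecutive entries c_{k-1}, c_k, c_{k+1} by the
-- single entry c_{k-1} + c_{k+1}, stored where c_{k-1} was; the other entries
-- keep their order.  Again this is intended for m ≥ 3.  The outer removeAt
-- deletes c_{k+1}, whose position after the deletion of c_k is given by
-- punchOut.
merge : ∀ {m} → Vec ℤ m → Fin m → Vec ℤ (m ∸ 2)
merge {suc zero}    c k = []
merge {suc (suc n)} c k =
  removeAt (removeAt (updateAt c (prev k) (_+ lookup c (next k))) k)
           (punchOut (k≢next k))

-- If |c_k| ≥ 2 for every k, then by induction the first column (a , c) of the
-- product satisfies |a| > |c|, since |x a - c| ≥ 2 |a| - |c| > |a|; as the next
-- value of c is the current a, the lower left entry never vanishes again.  So
-- every cycle has an entry c_k ∈ {0, 1, -1}.  If m ≥ 3, then for this k one of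
--   η(w) η(1) η(y)  =   η(w - 1) η(y - 1),
--   η(w) η(0) η(y)  = - η(w + y),
--   η(w) η(-1) η(y) = - η(w + 1) η(y + 1)
-- applies to a rotation of the cycle that starts at c_{k-1}, and being an
-- ε-cycle is invariant under rotation.

{-# OPTIONS --safe #-}
module Submission where

open import Defs
open import Data.Empty using (⊥-elim)
open import Data.Fin.Base using (Fin; zero; suc; toℕ; fromℕ; inject₁; punchOut)
open import Data.Fin.Properties
  using (any?; toℕ-fromℕ<; toℕ-inject₁; toℕ-fromℕ; toℕ-injective; toℕ<n)
open import Data.Fin.Relation.Unary.Top using (view; ‵fromℕ; ‵inject₁)
open import Data.Integer.Base
  using (ℤ; +_; -[1+_]; 0ℤ; 1ℤ; -1ℤ; _+_; _*_; -_; _◃_; ∣_∣)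
open import Data.Integer.Properties using (abs-*; ∣i+j∣≤∣i∣+∣j∣)
open import Data.Integer.Tactic.RingSolver using (solve-∀)
open import Data.List.Base using (List; []; _∷_; _++_)
open import Data.Nat.Base as ℕ using (ℕ; NonZero; _≤_; zero; suc; s≤s; z≤n)
import Data.Nat.Properties as ℕ
open import Data.Nat.DivMod using (_mod_; _%_; m%n<n; n%n≡0; m<n⇒m%n≡m; [m+n]%n≡m%n)
open import Data.Product.Base using (_×_; _,_; ∃-syntax; ∃₂)
open import Data.Sign.Base as Sign using (Sign; opposite)
open import Data.Sum.Base using (_⊎_; inj₁; inj₂)
open import Data.Vec.Base using (Vec; []; _∷_; lookup; toList; removeAt; updateAt)
open import Relation.Binary.PropositionalEquality
  using (_≡_; _≢_; refl; sym; trans; cong; cong₂; subst; module ≡-Reasoning)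
open import Relation.Nullary using (¬_; yes; no)

-- Algebra of 2 by 2 matrices.

mat-cong : ∀ {a b c d a′ b′ c′ d′} → a ≡ a′ → b ≡ b′ → c ≡ c′ → d ≡ d′ →
  mat a b c d ≡ mat a′ b′ c′ d′
mat-cong refl refl refl refl = refl

·-assoc : ∀ A B C → (A · B) · C ≡ A · (B · C)
·-assoc (mat a b c d) (mat e f g h) (mat i j k l) = mat-cong
  (entry a b e f g h i k) (entry a b e f g h j l)
  (entry c d e f g h i k) (entry c d e f g h j l)
  where
  entry : ∀ a b e f g h i k →
    (a * e + b * g) * i + (a * f + b * h) * k ≡ a * (e * i + f * k) + b * (g * i + h * k)
  entry = solve-∀

·-identityˡ : ∀ A → scalar 1ℤ · A ≡ A
·-identityˡ (mat a b c d) = mat-cong (top a c) (top b d) (bottom a c) (bottom b d)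
  where
  top : ∀ a c → 1ℤ * a + 0ℤ * c ≡ a
  top = solve-∀
  bottom : ∀ a c → 0ℤ * a + 1ℤ * c ≡ c
  bottom = solve-∀

scalar-comm : ∀ x A → scalar x · A ≡ A · scalar x
scalar-comm x (mat a b c d) =
  mat-cong (left x a c b) (right x b d a) (left′ x a c d) (right′ x b d c)
  where
  left : ∀ x a c b → x * a + 0ℤ * c ≡ a * x + b * 0ℤ
  left = solve-∀
  right : ∀ x b d a → x * b + 0ℤ * d ≡ a * 0ℤ + b * x
  right = solve-∀
  left′ : ∀ x a c d → 0ℤ * a + x * c ≡ c * x + d * 0ℤ
  left′ = solve-∀
  right′ : ∀ x b d c → 0ℤ * b + x * d ≡ c * 0ℤ + d * x
  right′ = solve-∀

·-identityʳ : ∀ A → A · scalar 1ℤ ≡ A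
·-identityʳ A = trans (sym (scalar-comm 1ℤ A)) (·-identityˡ A)

η⁻¹ : ℤ → Mat₂
η⁻¹ c = mat 0ℤ 1ℤ -1ℤ c

η⁻¹·η : ∀ c → η⁻¹ c · η c ≡ scalar 1ℤ
η⁻¹·η c = mat-cong (e₁ c) refl (e₂ c) (e₃ c)
  where
  e₁ : ∀ c → 0ℤ * c + 1ℤ * 1ℤ ≡ 1ℤ
  e₁ = solve-∀
  e₂ : ∀ c → -1ℤ * c + c * 1ℤ ≡ 0ℤ
  e₂ = solve-∀
  e₃ : ∀ c → -1ℤ * -1ℤ + c * 0ℤ ≡ 1ℤ
  e₃ = solve-∀

-- `A · η x` is the conjugate of `η x · A` by `η x`, and conjugation fixes scalar matrices.
η-rotate : ∀ x e {A} → η x · A ≡ scalar e → A · η x ≡ scalar e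
η-rotate x e {A} ηA≡e = begin
  A · η x                        ≡⟨ cong (_· η x) (sym (·-identityˡ A)) ⟩
  scalar 1ℤ · A · η x            ≡⟨ cong (λ B → B · A · η x) (sym (η⁻¹·η x)) ⟩
  η⁻¹ x · η x · A · η x          ≡⟨ cong (_· η x) (·-assoc (η⁻¹ x) (η x) A) ⟩
  η⁻¹ x · (η x · A) · η x        ≡⟨ cong (λ B → η⁻¹ x · B · η x) ηA≡e ⟩
  η⁻¹ x · scalar e · η x         ≡⟨ cong (_· η x) (sym (scalar-comm e (η⁻¹ x))) ⟩
  scalar e · η⁻¹ x · η x         ≡⟨ ·-assoc (scalar e) (η⁻¹ x) (η x) ⟩
  scalar e · (η⁻¹ x · η x)       ≡⟨ cong (scalar e ·_) (η⁻¹·η x) ⟩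
  scalar e · scalar 1ℤ           ≡⟨ ·-identityʳ (scalar e) ⟩
  scalar e                       ∎
  where open ≡-Reasoning

-- Products over lists and their rotations.

ηs : List ℤ → Mat₂
ηs []       = scalar 1ℤ
ηs (x ∷ xs) = η x · ηs xs

ηs-toList : ∀ {m} (c : Vec ℤ m) → ηProduct c ≡ ηs (toList c)
ηs-toList []      = refl
ηs-toList (x ∷ c) = cong (η x ·_) (ηs-toList c)

ηs-++ : ∀ xs ys → ηs (xs ++ ys) ≡ ηs xs · ηs ys
ηs-++ []       ys = sym (·-identityˡ (ηs ys))
ηs-++ (x ∷ xs) ys =
  trans (cong (η x ·_) (ηs-++ xs ys)) (sym (·-assoc (η x) (ηs xs) (ηs ys)))

-- One factor at a time: `η-rotate` carries `η x` to the far right, and the induction hypothesis is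
-- applied with `A · η x` in place of `A`.
ηs-rotate : ∀ xs e {A} → ηs xs · A ≡ scalar e → A · ηs xs ≡ scalar e
ηs-rotate []       e {A} eq = trans (sym (scalar-comm 1ℤ A)) eq
ηs-rotate (x ∷ xs) e {A} eq = trans (sym (·-assoc A (η x) (ηs xs)))
  (ηs-rotate xs e (trans (sym (·-assoc (ηs xs) A (η x)))
    (η-rotate x e (trans (sym (·-assoc (η x) (ηs xs) A)) eq))))

infix 4 _↻_

-- A rotation is given by its cut, so that both products factor through `ηs-++`.
_↻_ : List ℤ → List ℤ → Set
xs ↻ ys = ∃₂ λ ps qs → xs ≡ ps ++ qs × ys ≡ qs ++ ps

ηs-↻ : ∀ {xs ys} e → xs ↻ ys → ηs xs ≡ scalar e → ηs ys ≡ scalar e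
ηs-↻ e (ps , qs , refl , refl) eq =
  trans (ηs-++ qs ps) (ηs-rotate ps e (trans (sym (ηs-++ ps qs)) eq))

-- Local identities and their effect on the sign.

η-zero : ∀ w y → η w · (η 0ℤ · η y) ≡ scalar -1ℤ · η (w + y)
η-zero w y = mat-cong (e₁ w y) (e₂ w) (e₃ w y) refl
  where
  e₁ : ∀ w y → w * (0ℤ * y + -1ℤ * 1ℤ) + -1ℤ * (1ℤ * y + 0ℤ * 1ℤ) ≡ -1ℤ * (w + y) + 0ℤ * 1ℤ
  e₁ = solve-∀
  e₂ : ∀ w → w * (0ℤ * -1ℤ + -1ℤ * 0ℤ) + -1ℤ * (1ℤ * -1ℤ + 0ℤ * 0ℤ) ≡ -1ℤ * -1ℤ + 0ℤ * 0ℤ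
  e₂ = solve-∀
  e₃ : ∀ w y → 1ℤ * (0ℤ * y + -1ℤ * 1ℤ) + 0ℤ * (1ℤ * y + 0ℤ * 1ℤ) ≡ 0ℤ * (w + y) + -1ℤ * 1ℤ
  e₃ = solve-∀

-- Treats the entries 1 and -1 together: each neighbour loses `x`, and the sign `x` comes out in
-- front.
η-unit : ∀ s w y → let x = s ◃ 1 in
  η w · (η x · η y) ≡ scalar x · (η (w + - x) · η (y + - x))
η-unit Sign.+ w y = mat-cong (e₁ w y) (e₂ w) (e₃ w y) refl
  where
  e₁ : ∀ w y → w * (1ℤ * y + -1ℤ * 1ℤ) + -1ℤ * (1ℤ * y + 0ℤ * 1ℤ)
             ≡ 1ℤ * ((w + -1ℤ) * (y + -1ℤ) + -1ℤ * 1ℤ) + 0ℤ * (1ℤ * (y + -1ℤ) + 0ℤ * 1ℤ)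
  e₁ = solve-∀
  e₂ : ∀ w → w * (1ℤ * -1ℤ + -1ℤ * 0ℤ) + -1ℤ * (1ℤ * -1ℤ + 0ℤ * 0ℤ)
             ≡ 1ℤ * ((w + -1ℤ) * -1ℤ + -1ℤ * 0ℤ) + 0ℤ * (1ℤ * -1ℤ + 0ℤ * 0ℤ)
  e₂ = solve-∀
  e₃ : ∀ w y → 1ℤ * (1ℤ * y + -1ℤ * 1ℤ) + 0ℤ * (1ℤ * y + 0ℤ * 1ℤ)
             ≡ 0ℤ * ((w + -1ℤ) * (y + -1ℤ) + -1ℤ * 1ℤ) + 1ℤ * (1ℤ * (y + -1ℤ) + 0ℤ * 1ℤ)
  e₃ = solve-∀
η-unit Sign.- w y = mat-cong (e₁ w y) (e₂ w) (e₃ w y) refl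
  where
  e₁ : ∀ w y → w * (-1ℤ * y + -1ℤ * 1ℤ) + -1ℤ * (1ℤ * y + 0ℤ * 1ℤ)
             ≡ -1ℤ * ((w + 1ℤ) * (y + 1ℤ) + -1ℤ * 1ℤ) + 0ℤ * (1ℤ * (y + 1ℤ) + 0ℤ * 1ℤ)
  e₁ = solve-∀
  e₂ : ∀ w → w * (-1ℤ * -1ℤ + -1ℤ * 0ℤ) + -1ℤ * (1ℤ * -1ℤ + 0ℤ * 0ℤ)
             ≡ -1ℤ * ((w + 1ℤ) * -1ℤ + -1ℤ * 0ℤ) + 0ℤ * (1ℤ * -1ℤ + 0ℤ * 0ℤ)
  e₂ = solve-∀
  e₃ : ∀ w y → 1ℤ * (-1ℤ * y + -1ℤ * 1ℤ) + 0ℤ * (1ℤ * y + 0ℤ * 1ℤ)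
             ≡ 0ℤ * ((w + 1ℤ) * (y + 1ℤ) + -1ℤ * 1ℤ) + -1ℤ * (1ℤ * (y + 1ℤ) + 0ℤ * 1ℤ)
  e₃ = solve-∀

replace-prefix : ∀ s us vs zs ε → ηs us ≡ scalar (s ◃ 1) · ηs vs →
  ηs (us ++ zs) ≡ scalar (ε ◃ 1) → ηs (vs ++ zs) ≡ scalar ((s Sign.* ε) ◃ 1)
replace-prefix s us vs zs ε us≡vs eq = begin
  ηs (vs ++ zs)                  ≡⟨ ηs-++ vs zs ⟩
  ηs vs · ηs zs                  ≡⟨ ·-identityˡ (ηs vs · ηs zs) ⟨
  -- A sign squares to 1: one copy of `S` turns `vs` back into `us`, the other multiplies `ε`.
  scalar 1ℤ · (ηs vs · ηs zs)    ≡⟨ cong (_· (ηs vs · ηs zs)) (involutive s) ⟨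
  S · S · (ηs vs · ηs zs)        ≡⟨ ·-assoc S S (ηs vs · ηs zs) ⟩
  S · (S · (ηs vs · ηs zs))      ≡⟨ cong (S ·_) (·-assoc S (ηs vs) (ηs zs)) ⟨
  S · (S · ηs vs · ηs zs)        ≡⟨ cong (λ A → S · (A · ηs zs)) us≡vs ⟨
  S · (ηs us · ηs zs)            ≡⟨ cong (S ·_) (ηs-++ us zs) ⟨
  S · ηs (us ++ zs)              ≡⟨ cong (S ·_) eq ⟩
  S · scalar (ε ◃ 1)             ≡⟨ multiply s ε ⟩
  scalar ((s Sign.* ε) ◃ 1)      ∎
  where
  open ≡-Reasoning
  S = scalar (s ◃ 1)
  involutive : ∀ s → scalar (s ◃ 1) · scalar (s ◃ 1) ≡ scalar 1ℤ
  involutive Sign.+ = refl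
  involutive Sign.- = refl
  multiply : ∀ s ε → scalar (s ◃ 1) · scalar (ε ◃ 1) ≡ scalar ((s Sign.* ε) ◃ 1)
  multiply Sign.+ Sign.+ = refl
  multiply Sign.+ Sign.- = refl
  multiply Sign.- Sign.+ = refl
  multiply Sign.- Sign.- = refl

-- Existence of an entry of absolute value at most 1.

abs-grows : ∀ x a c → 2 ≤ ∣ x ∣ → ∣ c ∣ ℕ.< ∣ a ∣ → ∣ a ∣ ℕ.< ∣ x * a + -1ℤ * c ∣
-- Adding `∣ a ∣` to both sides avoids subtraction in ℕ.
abs-grows x a c 2≤∣x∣ c<a = ℕ.+-cancelʳ-< _ _ _ (begin-strict
  ∣ a ∣ ℕ.+ ∣ a ∣                       ≡⟨ cong (∣ a ∣ ℕ.+_) (ℕ.+-identityʳ ∣ a ∣) ⟨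
  2 ℕ.* ∣ a ∣                           ≤⟨ ℕ.*-monoˡ-≤ ∣ a ∣ 2≤∣x∣ ⟩
  ∣ x ∣ ℕ.* ∣ a ∣                       ≡⟨ abs-* x a ⟨
  ∣ x * a ∣                             ≡⟨ cong ∣_∣ (split (x * a) c) ⟩
  ∣ x * a + -1ℤ * c + c ∣               ≤⟨ ∣i+j∣≤∣i∣+∣j∣ (x * a + -1ℤ * c) c ⟩
  ∣ x * a + -1ℤ * c ∣ ℕ.+ ∣ c ∣         <⟨ ℕ.+-monoʳ-< ∣ x * a + -1ℤ * c ∣ c<a ⟩
  ∣ x * a + -1ℤ * c ∣ ℕ.+ ∣ a ∣         ∎)
  where
  open ℕ.≤-Reasoning
  split : ∀ b c → b ≡ b + -1ℤ * c + c
  split = solve-∀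

η-second-row : ∀ a c → 1ℤ * a + 0ℤ * c ≡ a
η-second-row = solve-∀

e₂₁<e₁₁ : ∀ {m} (c : Vec ℤ m) → (∀ k → 2 ≤ ∣ lookup c k ∣) →
  ∣ Mat₂.e₂₁ (ηProduct c) ∣ ℕ.< ∣ Mat₂.e₁₁ (ηProduct c) ∣
-- The first column of the identity is (1, 0).
e₂₁<e₁₁ []      big = s≤s z≤n
e₂₁<e₁₁ (x ∷ c) big = subst (λ b → ∣ b ∣ ℕ.< ∣ x * a + -1ℤ * d ∣) (sym (η-second-row a d))
  (abs-grows x a d (big zero) (e₂₁<e₁₁ c (λ k → big (suc k))))
  where
  a = Mat₂.e₁₁ (ηProduct c)
  d = Mat₂.e₂₁ (ηProduct c)

-- The lower left entry of the whole product is the upper left entry `a` of the product over the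
-- tail. A cycle forces `a` to be 0, against `∣ d ∣ < ∣ a ∣`.
entries≥2⇒¬cycle : ∀ ε {m} (c : Vec ℤ (suc m)) → (∀ k → 2 ≤ ∣ lookup c k ∣) → ¬ IsCycle ε c
entries≥2⇒¬cycle ε (x ∷ c) big cycle =
  ℕ.n≮0 (subst (λ b → ∣ d ∣ ℕ.< ∣ b ∣) a≡0 (e₂₁<e₁₁ c (λ k → big (suc k))))
  where
  a = Mat₂.e₁₁ (ηProduct c)
  d = Mat₂.e₂₁ (ηProduct c)
  a≡0 : a ≡ 0ℤ
  a≡0 = trans (sym (η-second-row a d)) (cong Mat₂.e₂₁ cycle)

small-entry : ∀ ε {m} (c : Vec ℤ (suc m)) → IsCycle ε c → ∃[ k ] ∣ lookup c k ∣ ≤ 1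
small-entry ε c cycle with any? (λ k → ∣ lookup c k ∣ ℕ.≤? 1)
... | yes small = small
... | no ¬small =
  ⊥-elim (entries≥2⇒¬cycle ε c (λ k → ℕ.≰⇒> (λ ≤1 → ¬small (k , ≤1))) cycle)

-- Updates and deletions in vectors, read as lists.

module _ {a} {A : Set a} where

  -- `removeAt` at `suc i` reduces only on a visibly nonempty tail, which a stuck `updateAt` is not.
  removeAt-suc : ∀ {n} (x : A) (xs : Vec A (suc n)) i →
    removeAt (x ∷ xs) (suc i) ≡ x ∷ removeAt xs i
  removeAt-suc x (y ∷ xs) i = refl

  -- Serves `k = 0`, whose left neighbour is the last entry. The decomposition is chosen before `f`,
  -- so contraction and merging share it.
  toList-updateAt-last : ∀ {n} (v : Vec A (suc n)) → ∃₂ λ ps w →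
    toList v ≡ ps ++ w ∷ [] ×
    (∀ f → toList (updateAt v (fromℕ n) f) ≡ ps ++ f w ∷ [])
  toList-updateAt-last (w ∷ []) = [] , w , refl , λ f → refl
  toList-updateAt-last (x ∷ v@(_ ∷ _)) =
    let ps , w , eq , updated = toList-updateAt-last v in
    x ∷ ps , w , cong (x ∷_) eq , λ f → cong (x ∷_) (updated f)

  -- Serves the last index `k`, with `v` the tail of the cycle: the right neighbour is the head of
  -- the cycle, outside `v`.
  toList-removeAt-last : ∀ {n} (v : Vec A (2 ℕ.+ n)) → ∃₂ λ ps w →
    toList v ≡ ps ++ w ∷ lookup v (fromℕ (suc n)) ∷ [] ×
    (∀ f → toList (removeAt (updateAt v (inject₁ (fromℕ n)) f) (fromℕ (suc n)))
           ≡ ps ++ f w ∷ [])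
  toList-removeAt-last (w ∷ x ∷ []) = [] , w , refl , λ f → refl
  toList-removeAt-last {suc n} (z ∷ v@(_ ∷ _ ∷ _)) =
    let ps , w , eq , removed = toList-removeAt-last v in
    z ∷ ps , w , cong (z ∷_) eq , λ f →
      trans (cong toList (removeAt-suc z (updateAt v (inject₁ (fromℕ n)) f) (fromℕ (suc n))))
            (cong (z ∷_) (removed f))

  -- Serves an index `k` whose neighbours `h` and `l` do not wrap around. The second deletion is at
  -- `suc i` because removing position `k` shifts `l` down by one.
  toList-removeAt-interior : ∀ {n} (v : Vec A (2 ℕ.+ n)) (i : Fin n) → ∃₂ λ ps w → ∃[ qs ]
    let h = inject₁ (inject₁ i); k = suc (inject₁ i); l = suc (suc i) in
    toList v ≡ ps ++ w ∷ lookup v k ∷ lookup v l ∷ qs ×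
    (∀ f g → toList (removeAt (updateAt (updateAt v h f) l g) k)
             ≡ ps ++ f w ∷ g (lookup v l) ∷ qs) ×
    (∀ f → toList (removeAt (removeAt (updateAt v h f) k) (suc i)) ≡ ps ++ f w ∷ qs)
  toList-removeAt-interior (w ∷ x ∷ y ∷ v) zero =
    [] , w , toList v , refl , (λ f g → refl) , λ f → refl
  toList-removeAt-interior (z ∷ v) (suc i) =
    let ps , w , qs , eq , removed , removed₂ = toList-removeAt-interior v i
        h = inject₁ (inject₁ i); k = suc (inject₁ i); l = suc (suc i)
    in
    z ∷ ps , w , qs , cong (z ∷_) eq ,
    (λ f g → trans (cong toList (removeAt-suc z (updateAt (updateAt v h f) l g) k))
                   (cong (z ∷_) (removed f g))) ,
    λ f → trans
      (cong (λ u → toList (removeAt u (suc (suc i)))) (removeAt-suc z (updateAt v h f) k))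
      (trans (cong toList (removeAt-suc z (removeAt (updateAt v h f) k) (suc i)))
             (cong (z ∷_) (removed₂ f)))

-- Cyclic neighbours of an index.

mod-toℕ : ∀ {n} m (i : Fin (suc n)) → m % suc n ≡ toℕ i → m mod suc n ≡ i
mod-toℕ {n} m i eq = toℕ-injective (trans (toℕ-fromℕ< (m%n<n m (suc n))) eq)

prev-zero : ∀ n → prev {n} zero ≡ fromℕ n
prev-zero n = mod-toℕ n (fromℕ n) (trans (m<n⇒m%n≡m (ℕ.n<1+n n)) (sym (toℕ-fromℕ n)))

prev-suc : ∀ {n} (i : Fin n) → prev (suc i) ≡ inject₁ i
prev-suc {n} i = mod-toℕ (suc (toℕ i) ℕ.+ n) (inject₁ i) (begin
  (suc (toℕ i) ℕ.+ n) % suc n   ≡⟨ cong (_% suc n) (ℕ.+-suc (toℕ i) n) ⟨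
  (toℕ i ℕ.+ suc n) % suc n     ≡⟨ [m+n]%n≡m%n (toℕ i) (suc n) ⟩
  toℕ i % suc n                 ≡⟨ m<n⇒m%n≡m (ℕ.m<n⇒m<1+n (toℕ<n i)) ⟩
  toℕ i                         ≡⟨ toℕ-inject₁ i ⟨
  toℕ (inject₁ i)               ∎)
  where open ≡-Reasoning

next-inject₁ : ∀ {n} (i : Fin n) → next (inject₁ i) ≡ suc i
next-inject₁ {n} i = mod-toℕ (suc (toℕ (inject₁ i))) (suc i)
  (trans (cong (λ j → suc j % suc n) (toℕ-inject₁ i)) (m<n⇒m%n≡m (s≤s (toℕ<n i))))

next-fromℕ : ∀ n → next (fromℕ n) ≡ zero
next-fromℕ n = mod-toℕ (suc (toℕ (fromℕ n))) zero
  (trans (cong (λ j → suc j % suc n) (toℕ-fromℕ n)) (n%n≡0 (suc n)))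

punchOut-inject₁ : ∀ {n} (i : Fin n) (i≢1+i : inject₁ i ≢ suc i) → punchOut i≢1+i ≡ i
punchOut-inject₁ zero    _ = refl
punchOut-inject₁ (suc i) i≢1+i = cong suc (punchOut-inject₁ i _)

-- Contraction and merging as rotations of lists.

contract-at : ∀ {n} δ (c : Vec ℤ (suc n)) k {h l} → prev k ≡ h → next k ≡ l →
  contract δ c k ≡ removeAt (updateAt (updateAt c h (_+ δ)) l (_+ δ)) k
contract-at δ c k refl refl = refl

-- The position `j` is required for every proof of `k ≢ l`, since replacing `next k` by `l`
-- transports `k≢next k` to a proof with no canonical form.
merge-at : ∀ {n} (c : Vec ℤ (2 ℕ.+ n)) k {h l j} → prev k ≡ h → next k ≡ l →
  (∀ (k≢l : k ≢ l) → punchOut k≢l ≡ j) →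
  merge c k ≡ removeAt (removeAt (updateAt c h (_+ lookup c l)) k) j
merge-at c k refl refl punched =
  cong (removeAt (removeAt (updateAt c (prev k) (_+ lookup c (next k))) k)) (punched (k≢next k))

-- Separates positions from algebra: with the entries around `k` rotated to the front, each
-- reduction only rewrites a prefix. The last two rotations lead back to the vector.
record Neighbours {m} (c : Vec ℤ m) (k : Fin m) : Set where
  field
    w y        : ℤ
    rest       : List ℤ
    rotated    : toList c ↻ w ∷ lookup c k ∷ y ∷ rest
    contracted : ∀ δ → w + δ ∷ y + δ ∷ rest ↻ toList (contract δ c k)
    merged     : w + y ∷ rest ↻ toList (merge c k)

-- The index is first, last or interior; in the first two cases one neighbour lies across the end of
-- the vector.
neighbours : ∀ {n} (c : Vec ℤ (3 ℕ.+ n)) k → Neighbours c k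
neighbours {n} c@(x ∷ y ∷ v) zero =
  let ps , w , eq , updated = toList-updateAt-last v
      h≡ = prev-zero (2 ℕ.+ n)
      l≡ = next-inject₁ {2 ℕ.+ n} zero
  in record
  { w = w ; y = y ; rest = ps
  ; rotated    = x ∷ y ∷ ps , w ∷ [] , cong (λ vs → x ∷ y ∷ vs) eq , refl
  ; contracted = λ δ → w + δ ∷ [] , y + δ ∷ ps , refl ,
      trans (cong toList (contract-at δ c zero h≡ l≡)) (cong (y + δ ∷_) (updated (_+ δ)))
  -- The sum takes the place of `w` at the end of the vector, so the cut follows the first list
  -- entry.
  ; merged     = w + y ∷ [] , ps , refl ,
      trans (cong toList (merge-at c zero h≡ l≡ (λ _ → refl))) (updated (_+ y))
  }
neighbours {n} c@(y ∷ v) (suc i) with view i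
... | ‵fromℕ =
  let ps , w , eq , removed = toList-removeAt-last v
      k = fromℕ (2 ℕ.+ n)
      v′ = λ δ → updateAt v (inject₁ (fromℕ n)) (_+ δ)
      h≡ = prev-suc (fromℕ (suc n))
      l≡ = next-fromℕ (2 ℕ.+ n)
  in record
  { w = w ; y = y ; rest = ps
  ; rotated    = y ∷ ps , w ∷ lookup c k ∷ [] , cong (y ∷_) eq , refl
  ; contracted = λ δ → w + δ ∷ [] , y + δ ∷ ps , refl ,
      trans (cong toList (trans (contract-at δ c k h≡ l≡)
                                (removeAt-suc (y + δ) (v′ δ) (fromℕ (suc n)))))
            (cong (y + δ ∷_) (removed (_+ δ)))
  ; merged     = w + y ∷ [] , ps , refl ,
      trans (cong toList (trans (merge-at c k h≡ l≡ (λ _ → refl))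
              (cong (λ u → removeAt u zero) (removeAt-suc y (v′ y) (fromℕ (suc n))))))
            (removed (_+ y))
  }
... | ‵inject₁ j =
  let ps , w , qs , eq , removed , removed₂ = toList-removeAt-interior c j
      k = suc (inject₁ j)
      l = suc (suc j)
      h≡ = prev-suc (inject₁ j)
      l≡ = next-inject₁ (suc j)
  in record
  { w = w ; y = lookup c l ; rest = qs ++ ps
  ; rotated    = ps , w ∷ lookup c k ∷ lookup c l ∷ qs , eq , refl
  ; contracted = λ δ → w + δ ∷ lookup c l + δ ∷ qs , ps , refl ,
      trans (cong toList (contract-at δ c k h≡ l≡)) (removed (_+ δ) (_+ δ))
  ; merged     = w + lookup c l ∷ qs , ps , refl ,
      trans (cong toList (merge-at c k h≡ l≡ (punchOut-inject₁ (suc j))))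
            (removed₂ (_+ lookup c l))
  }

-- Reductions of cycles.

ηs-pair : ∀ x y → ηs (x ∷ y ∷ []) ≡ η x · η y
ηs-pair x y = cong (η x ·_) (·-identityʳ (η y))

ηs-triple : ∀ w x y → ηs (w ∷ x ∷ y ∷ []) ≡ η w · (η x · η y)
ηs-triple w x y = cong (η w ·_) (ηs-pair x y)

toList-cycle : ∀ ε {m} (c : Vec ℤ m) {xs} → toList c ↻ xs → IsCycle ε c → ηs xs ≡ scalar (ε ◃ 1)
toList-cycle ε c c↻xs cycle = ηs-↻ (ε ◃ 1) c↻xs (trans (sym (ηs-toList c)) cycle)

cycle-toList : ∀ ε {m} (c : Vec ℤ m) {xs} → xs ↻ toList c → ηs xs ≡ scalar (ε ◃ 1) → IsCycle ε c
cycle-toList ε c xs↻c eq = trans (ηs-toList c) (ηs-↻ (ε ◃ 1) xs↻c eq)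

cycle-contract : ∀ s ε {n} (c : Vec ℤ (3 ℕ.+ n)) k → lookup c k ≡ s ◃ 1 → IsCycle ε c →
  IsCycle (s Sign.* ε) (contract (- (s ◃ 1)) c k)
cycle-contract s ε c k ck≡ cycle =
  cycle-toList (s Sign.* ε) (contract (- x) c k) (contracted (- x))
    (replace-prefix s (w ∷ lookup c k ∷ y ∷ []) (w + - x ∷ y + - x ∷ []) rest ε
      local (toList-cycle ε c rotated cycle))
  where
  open Neighbours (neighbours c k)
  open ≡-Reasoning
  x = s ◃ 1
  local : ηs (w ∷ lookup c k ∷ y ∷ []) ≡ scalar x · ηs (w + - x ∷ y + - x ∷ [])
  local = begin
    ηs (w ∷ lookup c k ∷ y ∷ [])              ≡⟨ ηs-triple w (lookup c k) y ⟩
    η w · (η (lookup c k) · η y)              ≡⟨ cong (λ z → η w · (η z · η y)) ck≡ ⟩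
    η w · (η x · η y)                         ≡⟨ η-unit s w y ⟩
    scalar x · (η (w + - x) · η (y + - x))    ≡⟨ cong (scalar x ·_) (ηs-pair (w + - x) (y + - x)) ⟨
    scalar x · ηs (w + - x ∷ y + - x ∷ [])    ∎

cycle-merge : ∀ ε {n} (c : Vec ℤ (3 ℕ.+ n)) k → lookup c k ≡ 0ℤ → IsCycle ε c →
  IsCycle (opposite ε) (merge c k)
cycle-merge ε c k ck≡ cycle =
  cycle-toList (opposite ε) (merge c k) merged
    -- The identity for 0 carries the sign -1, and `Sign.- Sign.* ε` computes to `opposite ε`.
    (replace-prefix Sign.- (w ∷ lookup c k ∷ y ∷ []) (w + y ∷ []) rest ε
      local (toList-cycle ε c rotated cycle))
  where
  open Neighbours (neighbours c k)
  open ≡-Reasoning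
  local : ηs (w ∷ lookup c k ∷ y ∷ []) ≡ scalar -1ℤ · ηs (w + y ∷ [])
  local = begin
    ηs (w ∷ lookup c k ∷ y ∷ [])     ≡⟨ ηs-triple w (lookup c k) y ⟩
    η w · (η (lookup c k) · η y)     ≡⟨ cong (λ z → η w · (η z · η y)) ck≡ ⟩
    η w · (η 0ℤ · η y)               ≡⟨ η-zero w y ⟩
    scalar -1ℤ · η (w + y)           ≡⟨ cong (scalar -1ℤ ·_) (·-identityʳ (η (w + y))) ⟨
    scalar -1ℤ · ηs (w + y ∷ [])     ∎

-- The off-diagonal entries of `η x · η y` are `- x` and `y`.
cycle₂-zero : ∀ ε x y → IsCycle ε (x ∷ y ∷ []) → x ≡ 0ℤ × y ≡ 0ℤ
cycle₂-zero ε x y cycle =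
  trans (upper-right x y) (cong (λ A → - Mat₂.e₁₂ A) cycle) ,
  trans (lower-left y) (cong Mat₂.e₂₁ cycle)
  where
  upper-right : ∀ x y → x ≡ - (x * (y * 0ℤ + -1ℤ * 1ℤ) + -1ℤ * (1ℤ * 0ℤ + 0ℤ * 1ℤ))
  upper-right = solve-∀
  lower-left : ∀ y → y ≡ 1ℤ * (y * 1ℤ + -1ℤ * 0ℤ) + 0ℤ * (1ℤ * 1ℤ + 0ℤ * 0ℤ)
  lower-left = solve-∀

theorem6p2 : (ε : Sign) (m : ℕ) .{{_ : NonZero m}} (c : Vec ℤ m) → IsCycle ε c →
    (m ≡ 2 × toList c ≡ 0ℤ ∷ 0ℤ ∷ [])
    ⊎ (3 ≤ m × ∃[ k ] (lookup c k ≡ 1ℤ × IsCycle ε (contract -1ℤ c k)))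
    ⊎ (3 ≤ m × ∃[ k ] (lookup c k ≡ 0ℤ × IsCycle (opposite ε) (merge c k)))
    ⊎ (3 ≤ m × ∃[ k ] (lookup c k ≡ -1ℤ × IsCycle (opposite ε) (contract 1ℤ c k)))
-- The lower left entry of `η x` is 1, so no cycle has length 1.
theorem6p2 ε 1 (x ∷ []) cycle with () ← cong Mat₂.e₂₁ cycle
theorem6p2 ε 2 (x ∷ y ∷ []) cycle =
  let x≡0 , y≡0 = cycle₂-zero ε x y cycle in
  inj₁ (refl , cong₂ (λ u v → u ∷ v ∷ []) x≡0 y≡0)
theorem6p2 ε (suc (suc (suc n))) c cycle with small-entry ε c cycle
-- The bound leaves only the values 0, 1 and -1, one for each reduction.
... | k , small with lookup c k in ck≡ | small
... | + 0            | _ =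
  inj₂ (inj₂ (inj₁ (s≤s (s≤s (s≤s z≤n)) , k , ck≡ , cycle-merge ε c k ck≡ cycle)))
... | + 1            | _ =
  inj₂ (inj₁ (s≤s (s≤s (s≤s z≤n)) , k , ck≡ , cycle-contract Sign.+ ε c k ck≡ cycle))
... | -[1+ 0 ]       | _ =
  inj₂ (inj₂ (inj₂ (s≤s (s≤s (s≤s z≤n)) , k , ck≡ , cycle-contract Sign.- ε c k ck≡ cycle)))
... | + suc (suc _)  | s≤s ()
... | -[1+ suc _ ]   | s≤s ()
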